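{- Let $T$ be a propositional theory over $\mathcal V$, let $(\mathcal A,\oplus,\otimes,e^\oplus,e^\otimes)$ be a commutative semiring, and let $\alpha:\mathcal L\to\mathcal A$ be a labeling function on the literals of $\mathcal V$. If $N_T$ is an sd-DNNF representation of $T$ (i.e. an NNF circuit over $\mathcal V$ that is smooth, deterministic and decomposable and that represents $T$), then evaluating $N_T$ is a sound AMC (algebraic model counting) computation, i.e. $$\mathrm{Eval}(N_T,\oplus,\otimes,e^\oplus,e^\otimes,\alpha)=\mathbf A(T).$$
   Context: A semiring $(\mathcal A,\oplus,\otimes,e^\oplus,e^\otimes)$ has associative binary operations $\oplus,\otimes$ on $\mathcal A$, with $\oplus$ commutative, $\otimes$ distributing over $\oplus$, $e^\oplus\in\mathcal A$ neutral for $\oplus$, $e^\otimes\in\mathcal A$ neutral for $\otimes$, and $e^\oplus\otimes a=a\otimes e^\oplus=e^\oplus$ for all $a\in\mathcal A$. It is commutative if $\otimes$ is also commutative. Algebraic model count: for a propositional theory $T$ over a finite set $\mathcal V$ of variables and $\alpha:\mathcal L\to\mathcal A$ on the set $\mathcal L$ of literals of the variables in $\mathcal V$, $$\mathbf A(T)=\bigoplus_{I\in\mathcal M(T)}\ \bigotimes_{l\in I}\alpha(l),$$ where $\mathcal M(T)$ is the set of models of $T$, each model being given as a set of literals containing exactly one of $v,\neg v$ for each $v\in\mathcal V$. Empty sums are $e^\oplus$, empty products $e^\otimes$. An NNF circuit (sentence in negation normal form) over $\mathcal V$ is a rooted directed acyclic graph whose leaves are labeled with true ($\top$), false ($\bot$)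 or a literal of a variable in $\mathcal V$, and whose internal nodes are labeled with disjunction ($\vee$) or conjunction ($\wedge$). Each node is identified with the formula of the subcircuit rooted at it; a circuit represents $T$ if its root formula is logically equivalent to $T$. The circuit is decomposable if for each conjunction node $\bigwedge_{i=1}^n\phi_i$ no two children $\phi_i,\phi_j$ ($i\ne j$) share any variable; deterministic if for each disjunction node $\bigvee_{i=1}^n\phi_i$ each pair of different children $\phi_i,\phi_j$ is logically inconsistent; smooth if for each disjunction node $\bigvee_{i=1}^n\phi_i$ each child mentions the same set of variables. $\mathrm{Eval}$ is defined recursively: $\top\mapsto e^\otimes$, $\bot\mapsto e^\oplus$, literal $l\mapsto\alpha(l)$, a disjunction node $\mapsto$ the $\oplus$-sum of the values of its children, a conjunction node $\mapsto$ the $\otimes$-product of the values of its children; the value of the circuit is that of its root.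
   Formalization: Added hypothesis: if T is satisfiable, the circuit mentions every variable of V. Without it the claim fails: for V={a}, T true, and the circuit ⊤ with all labels 1 over the natural numbers, Eval is 1 but A(T)=2. -}

module Defs where

open import Algebra.Bundles using (CommutativeSemiring)
open import Data.Bool.Base using (Bool; true; false; not; _∧_; _∨_; _xor_; if_then_else_)
open import Data.Bool.ListAction using (all)
open import Data.Fin.Base using (Fin)
open import Data.Fin.Induction using (spo-noetherian)
open import Data.Fin.Subset as Subset using (Subset; ⁅_⁆; ⋃; _∩_; Empty)
open import Data.List.Base using (List; []; _∷_; _++_; map; foldr; filterᵇ; allFin)
open import Data.List.Membership.Propositional using (_∈_; mapWith∈)
open import Data.List.Membership.Propositional.Properties using (mapWith∈-cong; mapWith∈≗map)
open import Data.List.NonEmpty.Base using (List⁺; toList)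
open import Data.List.Relation.Unary.AllPairs using (AllPairs)
open import Data.Nat.Base using (ℕ; zero; suc)
open import Data.Product.Base using (_×_; ∃-syntax)
open import Data.Vec.Base as Vec using (Vec; lookup)
open import Function.Base using (flip)
open import Induction.WellFounded using (Acc; acc; WellFounded)
open import Relation.Binary.Construct.Closure.ReflexiveTransitive using (Star)
open import Relation.Binary.Construct.Closure.Transitive as Plus using (TransClosure; [_])
open import Relation.Binary.PropositionalEquality
  using (_≡_; refl; trans; cong; isEquivalence; resp₂)
open import Relation.Nullary.Negation using (¬_)

-- The finite set of variables is Fin n throughout.

data Literal (n : ℕ) : Set where
  pos neg : Fin n → Literal n

var : ∀ {n} → Literal n → Fin n
var (pos v) = v
var (neg v) = v

Interpretation : ℕ → Set
Interpretation n = Vec Bool n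

-- An interpretation as a set of literals: exactly one of pos v, neg v for
-- each variable v, listed without repetition.
literals : ∀ {n} → Interpretation n → List (Literal n)
literals {n} I = map (λ v → if lookup I v then pos v else neg v) (allFin n)

-- Lists every interpretation exactly once.
interpretations : ∀ n → List (Interpretation n)
interpretations zero    = Vec.[] ∷ []
interpretations (suc n) =
  map (true Vec.∷_) (interpretations n) ++ map (false Vec.∷_) (interpretations n)

infixr 6 _`∧_
infixr 5 _`∨_
infixr 4 _`⇒_ _`⇔_

data Formula (n : ℕ) : Set where
  atom                   : Fin n → Formula n
  `⊤ `⊥                  : Formula n
  `¬_                    : Formula n → Formula n
  _`∧_ _`∨_ _`⇒_ _`⇔_    : Formula n → Formula n → Formula n

Theory : ℕ → Set
Theory n = List (Formula n)

⟦_⟧ᶠ : ∀ {n} → Formula n → Interpretation n → Bool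
⟦ atom v ⟧ᶠ I = lookup I v
⟦ `⊤     ⟧ᶠ I = true
⟦ `⊥     ⟧ᶠ I = false
⟦ `¬ φ   ⟧ᶠ I = not (⟦ φ ⟧ᶠ I)
⟦ φ `∧ ψ ⟧ᶠ I = ⟦ φ ⟧ᶠ I ∧ ⟦ ψ ⟧ᶠ I
⟦ φ `∨ ψ ⟧ᶠ I = ⟦ φ ⟧ᶠ I ∨ ⟦ ψ ⟧ᶠ I
⟦ φ `⇒ ψ ⟧ᶠ I = not (⟦ φ ⟧ᶠ I) ∨ ⟦ ψ ⟧ᶠ I
⟦ φ `⇔ ψ ⟧ᶠ I = not (⟦ φ ⟧ᶠ I xor ⟦ ψ ⟧ᶠ I)

⟦_⟧ᵀ : ∀ {n} → Theory n → Interpretation n → Bool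
⟦ T ⟧ᵀ I = all (λ φ → ⟦ φ ⟧ᶠ I) T

models : ∀ {n} → Theory n → List (Interpretation n)
models {n} T = filterᵇ ⟦ T ⟧ᵀ (interpretations n)

Satisfiable : ∀ {n} → Theory n → Set
Satisfiable T = ∃[ I ] ⟦ T ⟧ᵀ I ≡ true

module _ {c ℓ} (R : CommutativeSemiring c ℓ) where
  open CommutativeSemiring R

  ⨁ ⨂ : List Carrier → Carrier
  ⨁ = foldr _+_ 0#
  ⨂ = foldr _*_ 1#

  modelCount : ∀ {n} → (Literal n → Carrier) → Theory n → Carrier
  modelCount α T = ⨁ (map (λ I → ⨂ (map α (literals I))) (models T))

-- Formulas in negation normal form; these are what circuit nodes denote.

data NNF (n : ℕ) : Set where
  ⊤ ⊥ : NNF n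
  lit : Literal n → NNF n
  ⋁ ⋀ : List (NNF n) → NNF n

⟦_⟧ˡ : ∀ {n} → Literal n → Interpretation n → Bool
⟦ pos v ⟧ˡ I = lookup I v
⟦ neg v ⟧ˡ I = not (lookup I v)

-- The auxiliary functions on lists are maps fused with folds, spelled out
-- for the termination checker.

mutual
  ⟦_⟧ : ∀ {n} → NNF n → Interpretation n → Bool
  ⟦ ⊤     ⟧ I = true
  ⟦ ⊥     ⟧ I = false
  ⟦ lit l ⟧ I = ⟦ l ⟧ˡ I
  ⟦ ⋁ φs  ⟧ I = any⟦ φs ⟧ I
  ⟦ ⋀ φs  ⟧ I = all⟦ φs ⟧ I

  any⟦_⟧ all⟦_⟧ : ∀ {n} → List (NNF n) → Interpretation n → Bool
  any⟦ []     ⟧ I = false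
  any⟦ φ ∷ φs ⟧ I = ⟦ φ ⟧ I ∨ any⟦ φs ⟧ I
  all⟦ []     ⟧ I = true
  all⟦ φ ∷ φs ⟧ I = ⟦ φ ⟧ I ∧ all⟦ φs ⟧ I

mutual
  vars : ∀ {n} → NNF n → Subset n
  vars ⊤       = Subset.⊥
  vars ⊥       = Subset.⊥
  vars (lit l) = ⁅ var l ⁆
  vars (⋁ φs)  = ⋃ (varsOfEach φs)
  vars (⋀ φs)  = ⋃ (varsOfEach φs)

  varsOfEach : ∀ {n} → List (NNF n) → List (Subset n)
  varsOfEach []       = []
  varsOfEach (φ ∷ φs) = vars φ ∷ varsOfEach φs

module _ {c ℓ} (R : CommutativeSemiring c ℓ) where
  open CommutativeSemiring R

  mutual
    evalNNF : ∀ {n} → (Literal n → Carrier) → NNF n → Carrier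
    evalNNF α ⊤       = 1#
    evalNNF α ⊥       = 0#
    evalNNF α (lit l) = α l
    evalNNF α (⋁ φs)  = ⨁ R (evalEach α φs)
    evalNNF α (⋀ φs)  = ⨂ R (evalEach α φs)

    evalEach : ∀ {n} → (Literal n → Carrier) → List (NNF n) → List Carrier
    evalEach α []       = []
    evalEach α (φ ∷ φs) = evalNNF α φ ∷ evalEach α φs

Inconsistent SameVars DisjointVars : ∀ {n} → NNF n → NNF n → Set
Inconsistent φ ψ = ∀ I → ¬ (⟦ φ ⟧ I ≡ true × ⟦ ψ ⟧ I ≡ true)
SameVars     φ ψ = vars φ ≡ vars ψ
DisjointVars φ ψ = Empty (vars φ ∩ vars ψ)

-- Node labels of a circuit over n variables with m nodes.  Internal nodes
-- carry their children, so they have at least one.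
data Label (n m : ℕ) : Set where
  ⊤ ⊥ : Label n m
  lit : Literal n → Label n m
  ⋁ ⋀ : List⁺ (Fin m) → Label n m

children : ∀ {n m} → Label n m → List (Fin m)
children ⊤       = []
children ⊥       = []
children (lit _) = []
children (⋁ us)  = toList us
children (⋀ us)  = toList us

record Circuit (n : ℕ) : Set where
  field
    size  : ℕ
    label : Fin size → Label n size
    root  : Fin size

  Node : Set
  Node = Fin size

  _⟶_ : Node → Node → Set
  _⟶_ u w = w ∈ children (label u)

  _⟶⁺_ : Node → Node → Set
  _⟶⁺_ = TransClosure _⟶_

  field
    acyclic : ∀ u → ¬ (u ⟶⁺ u)
    rooted  : ∀ u → Star _⟶_ root u

module _ {n} (N : Circuit n) where
  open Circuit N

  descending : WellFounded (flip _⟶⁺_)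
  descending = spo-noetherian record
    { isEquivalence = isEquivalence
    ; irrefl        = λ { refl → acyclic _ }
    ; trans         = Plus.transitive _⟶_
    ; <-resp-≈      = resp₂ _⟶⁺_
    }

  connect : (g : Label n size) → (∀ {w} → w ∈ children g → NNF n) → NNF n
  connect ⊤       f = ⊤
  connect ⊥       f = ⊥
  connect (lit l) f = lit l
  connect (⋁ us)  f = ⋁ (mapWith∈ (toList us) f)
  connect (⋀ us)  f = ⋀ (mapWith∈ (toList us) f)

  formulaAcc : ∀ u → Acc (flip _⟶⁺_) u → NNF n
  formulaAcc u (acc rs) = connect (label u) (λ u⟶w → formulaAcc _ (rs [ u⟶w ]))

  -- The formula of the subcircuit rooted at a node.
  formula : Node → NNF n
  formula u = formulaAcc u (descending u)

  connect-cong : ∀ g {f f′ : ∀ {w} → w ∈ children g → NNF n} →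
                 (∀ {w} (p : w ∈ children g) → f p ≡ f′ p) → connect g f ≡ connect g f′
  connect-cong ⊤       eq = refl
  connect-cong ⊥       eq = refl
  connect-cong (lit l) eq = refl
  connect-cong (⋁ us)  eq = cong ⋁ (mapWith∈-cong (toList us) _ _ eq)
  connect-cong (⋀ us)  eq = cong ⋀ (mapWith∈-cong (toList us) _ _ eq)

  formulaAcc-irrelevant : ∀ u (a b : Acc (flip _⟶⁺_) u) → formulaAcc u a ≡ formulaAcc u b
  formulaAcc-irrelevant u (acc rs) (acc ss) =
    connect-cong (label u) (λ p → formulaAcc-irrelevant _ (rs [ p ]) (ss [ p ]))

  formula-unfold : ∀ u → formula u ≡ connect (label u) (λ {w} _ → formula w)
  formula-unfold u with descending u
  ... | acc rs = connect-cong (label u) (λ p → formulaAcc-irrelevant _ (rs [ p ]) (descending _))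

  formula-⋁ : ∀ u {us} → label u ≡ ⋁ us → formula u ≡ ⋁ (map formula (toList us))
  formula-⋁ u {us} eq = trans (formula-unfold u)
    (trans (cong (λ g → connect g (λ {w} _ → formula w)) eq)
           (cong ⋁ (mapWith∈≗map formula (toList us))))

  formula-⋀ : ∀ u {us} → label u ≡ ⋀ us → formula u ≡ ⋀ (map formula (toList us))
  formula-⋀ u {us} eq = trans (formula-unfold u)
    (trans (cong (λ g → connect g (λ {w} _ → formula w)) eq)
           (cong ⋀ (mapWith∈≗map formula (toList us))))

  -- Each relation under AllPairs is symmetric, so AllPairs says that it holds
  -- between the children at any two different positions.

  Decomposable Deterministic Smooth : Set
  Decomposable  = ∀ u {us} → label u ≡ ⋀ us → AllPairs DisjointVars (map formula (toList us))
  Deterministic = ∀ u {us} → label u ≡ ⋁ us → AllPairs Inconsistent (map formula (toList us))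
  Smooth        = ∀ u {us} → label u ≡ ⋁ us → AllPairs SameVars (map formula (toList us))

  Represents : Theory n → Set
  Represents T = ∀ I → ⟦ formula root ⟧ I ≡ ⟦ T ⟧ᵀ I

  -- Node-wise smoothness leaves open that the circuit misses a variable v
  -- altogether; Eval would then lack the factor α(v) ⊕ α(¬v) of the model
  -- count, as for the circuit ⊤ over one variable.
  MentionsAllVariables : Set
  MentionsAllVariables = ∀ v → v Subset.∈ vars (formula root)

  Eval : ∀ {c ℓ} (R : CommutativeSemiring c ℓ) →
         (Literal n → CommutativeSemiring.Carrier R) → CommutativeSemiring.Carrier R
  Eval R α = evalNNF R α (formula root)

record IsSdDNNF {n} (N : Circuit n) : Set where
  field
    smooth        : Smooth N
    deterministic : Deterministic N
    decomposable  : Decomposable N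

{-# OPTIONS --safe #-}
module Submission where

-- For a set S of variables, let Σ_S F be the sum, over all assignments I to
-- the variables in S, of (⊗ of the labels of the literals of I) ⊗ F(I).
-- The theorem holds because every node φ of an sd-DNNF circuit satisfies
--
--     Eval φ = Σ_{vars φ} [φ]          (Correct φ),
--
-- where [φ] is 1 on the models of φ and 0 elsewhere.  This is shown by
-- well-founded induction on the nodes, using one property of the circuit in
-- each place:
--
--  * At a disjunction, determinism makes the indicator of the disjunction the
--    sum of the indicators of the children (indicator-∨), smoothness makes all
--    the sums range over the same S, and Σ_S is additive (correct-⋁).
--  * At a conjunction, the indicator is the product of the indicators of the
--    children.  Each of these depends on the variables of that child only
--    (indicator-dependsOnly), and Σ_{S ∪ T} (F ⊗ G) = Σ_S F ⊗ Σ_T G whenever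
--    S and T are disjoint and F, G depend on S, T only (sumOver-*); this
--    uses distributivity and the commutativity of ⊗ (correct-⋀).
--
-- At the root, Σ over the set of all variables of [T] is the model count
-- (modelCount-sumOver).  If the root does not mention all variables, then T is
-- unsatisfiable, and both sides vanish.

open import Defs
open import Algebra.Bundles using (CommutativeSemiring)
import Algebra.Properties.CommutativeSemigroup as CommutativeSemigroupProperties
open import Data.Bool.Base using (Bool; true; false; _∧_; _∨_; not; if_then_else_)
open import Data.Bool.Properties using (¬-not; if-float) renaming (_≟_ to _≟ᵇ_)
open import Data.Empty using (⊥-elim)
open import Data.Fin.Base using (Fin; zero; suc)
open import Data.Fin.Subset as Subset
  using (Subset; inside; outside; ⁅_⁆; ⋃; _∩_; _∪_; Empty)
open import Data.Fin.Subset.Properties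
  using (drop-∷-Empty; ∪-identityʳ; ∪-idem; p⊆p∪q; q⊆p∪q; x∈p∪q⁻; x∈p∩q⁺; x∈p∩q⁻;
         x∈⁅x⁆; ∉⊥; ⊆-antisym; ⊆-max)
open import Data.List.Base using (List; []; _∷_; _++_; map; filterᵇ; tabulate)
open import Data.List.Properties using (map-∘; map-++; map-tabulate; tabulate-cong)
open import Data.List.Relation.Unary.All as All using (All; []; _∷_)
import Data.List.Relation.Unary.All.Properties as All
open import Data.List.Relation.Unary.AllPairs using (AllPairs; []; _∷_)
open import Data.Nat.Base using (ℕ; suc)
open import Data.Product.Base using (_×_; _,_)
open import Data.Sum.Base using ([_,_]′)
open import Data.Vec.Base as Vec using (lookup; here; there)
open import Data.Vec.Properties using (≡-dec)
open import Function.Base using (_∘_; flip)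
open import Induction.WellFounded using (Acc; acc)
open import Relation.Binary.Construct.Closure.Transitive using ([_])
open import Relation.Binary.PropositionalEquality as ≡ using (_≡_; cong; cong₂; subst)
import Relation.Binary.Reasoning.Setoid as SetoidReasoning
open import Relation.Nullary.Decidable using (yes; no)
open import Relation.Nullary.Negation using (¬_)

-- Literals of an extended interpretation.

-- Renames variable v to suc v, making room for a new variable zero.
raise : ∀ {n} → Literal n → Literal (suc n)
raise (pos v) = pos (suc v)
raise (neg v) = neg (suc v)

-- The literal of v that is true when v has the truth value b.
choose : ∀ {n} → Bool → Fin n → Literal n
choose b v = if b then pos v else neg v

literals-∷ : ∀ {n} b (I : Interpretation n) →
             literals (b Vec.∷ I) ≡ choose b zero ∷ map raise (literals I)
literals-∷ b I = cong (choose b zero ∷_) (begin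
  map (λ v → choose (lookup (b Vec.∷ I) v) v) (tabulate suc)
    ≡⟨ map-tabulate suc _ ⟩
  tabulate (λ v → choose (lookup I v) (suc v))
    ≡⟨ tabulate-cong (λ v → if-float raise (lookup I v)) ⟨
  tabulate (λ v → raise (choose (lookup I v) v))
    ≡⟨ map-tabulate _ raise ⟨
  map raise (tabulate (λ v → choose (lookup I v) v))
    ≡⟨ cong (map raise) (map-tabulate (λ v → v) _) ⟨
  map raise (literals I) ∎)
  where open ≡.≡-Reasoning

-- The truth value of a formula is determined by its own variables.

-- I and J coincide on the variables in S.
Agree : ∀ {n} → Subset n → Interpretation n → Interpretation n → Set
Agree S I J = ∀ v → v Subset.∈ S → lookup I v ≡ lookup J v

⟦⟧ˡ-agree : ∀ {n} (l : Literal n) I J → Agree ⁅ var l ⁆ I J → ⟦ l ⟧ˡ I ≡ ⟦ l ⟧ˡ J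
⟦⟧ˡ-agree (pos v) I J eq = eq v (x∈⁅x⁆ v)
⟦⟧ˡ-agree (neg v) I J eq = cong not (eq v (x∈⁅x⁆ v))

mutual
  ⟦⟧-agree : ∀ {n} (φ : NNF n) I J → Agree (vars φ) I J → ⟦ φ ⟧ I ≡ ⟦ φ ⟧ J
  ⟦⟧-agree ⊤       I J eq = ≡.refl
  ⟦⟧-agree ⊥       I J eq = ≡.refl
  ⟦⟧-agree (lit l) I J eq = ⟦⟧ˡ-agree l I J eq
  ⟦⟧-agree (⋁ φs)  I J eq = any-agree φs I J eq
  ⟦⟧-agree (⋀ φs)  I J eq = all-agree φs I J eq

  any-agree : ∀ {n} (φs : List (NNF n)) I J →
              Agree (⋃ (varsOfEach φs)) I J → any⟦ φs ⟧ I ≡ any⟦ φs ⟧ J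
  any-agree []       I J eq = ≡.refl
  any-agree (φ ∷ φs) I J eq =
    cong₂ _∨_ (⟦⟧-agree φ I J (λ v → eq v ∘ p⊆p∪q _))
              (any-agree φs I J (λ v → eq v ∘ q⊆p∪q (vars φ) _))

  all-agree : ∀ {n} (φs : List (NNF n)) I J →
              Agree (⋃ (varsOfEach φs)) I J → all⟦ φs ⟧ I ≡ all⟦ φs ⟧ J
  all-agree []       I J eq = ≡.refl
  all-agree (φ ∷ φs) I J eq =
    cong₂ _∧_ (⟦⟧-agree φ I J (λ v → eq v ∘ p⊆p∪q _))
              (all-agree φs I J (λ v → eq v ∘ q⊆p∪q (vars φ) _))

-- From pairs of siblings to one child against a whole list of siblings.

-- Holds only for a nonempty list, since the empty union is the empty set.
⋃-constant : ∀ {n} {S : Subset n} φ φs → All (λ ψ → S ≡ vars ψ) (φ ∷ φs) →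
             S ≡ vars (⋁ (φ ∷ φs))
⋃-constant φ []       (p ∷ []) = ≡.trans p (≡.sym (∪-identityʳ (vars φ)))
⋃-constant φ (ψ ∷ φs) (p ∷ ps) =
  ≡.trans (≡.sym (∪-idem _)) (cong₂ _∪_ p (⋃-constant ψ φs ps))

smooth-vars : ∀ {n} (φs : List (NNF n)) → AllPairs SameVars φs →
              All (λ φ → vars φ ≡ vars (⋁ φs)) φs
smooth-vars []       []       = []
smooth-vars (φ ∷ φs) (p ∷ _) = eq ∷ All.map (λ q → ≡.trans (≡.sym q) eq) p
  where eq = ⋃-constant φ φs (≡.refl ∷ p)

inconsistent-any : ∀ {n} (φ : NNF n) {φs} → All (Inconsistent φ) φs →
                   ∀ I → ¬ (⟦ φ ⟧ I ≡ true × any⟦ φs ⟧ I ≡ true)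
inconsistent-any φ {ψ ∷ _} (p ∷ ps) I (t , u) with ⟦ ψ ⟧ I in eq
... | true  = p I (t , eq)
... | false = inconsistent-any φ ps I (t , u)

disjoint-⋃ : ∀ {n} {φ : NNF n} {φs} → All (DisjointVars φ) φs →
             Empty (vars φ ∩ ⋃ (varsOfEach φs))
disjoint-⋃ {φ = φ} {φs} ps (v , v∈) = go ps (x∈p∩q⁻ (vars φ) _ v∈)
  where
  go : ∀ {φs v} → All (DisjointVars φ) φs →
       ¬ (v Subset.∈ vars φ × v Subset.∈ ⋃ (varsOfEach φs))
  go []       (_ , u) = ∉⊥ u
  go {φs = ψ ∷ _} (p ∷ ps) (t , u) =
    [ (λ u′ → p (_ , x∈p∩q⁺ (t , u′))) , (λ u′ → go ps (t , u′)) ]′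
      (x∈p∪q⁻ (vars ψ) _ u)

module _ {c ℓ} (R : CommutativeSemiring c ℓ) where
  open CommutativeSemiring R hiding (zero)
  open SetoidReasoning setoid
  open CommutativeSemigroupProperties +-commutativeSemigroup
    using () renaming (interchange to +-interchange)
  open CommutativeSemigroupProperties *-commutativeSemigroup
    using () renaming (x∙yz≈y∙xz to x*yz≈y*xz)

  -- Weighted sums over the assignments to a set of variables.

  -- Σ_S F: the sum of (⊗ of the labels of the literals) ⊗ F over the
  -- assignments to S.  The variables outside S are set to true; this choice is
  -- immaterial when F depends on S only.
  sumOver : ∀ {n} → Subset n → (Literal n → Carrier) → (Interpretation n → Carrier) → Carrier
  sumOver Vec.[]            α F = F Vec.[]
  sumOver (inside  Vec.∷ S) α F =
    α (pos zero) * sumOver S (α ∘ raise) (F ∘ (true Vec.∷_)) +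
    α (neg zero) * sumOver S (α ∘ raise) (F ∘ (false Vec.∷_))
  sumOver (outside Vec.∷ S) α F = sumOver S (α ∘ raise) (F ∘ (true Vec.∷_))

  -- F is, up to ≈, a function of the values of the variables in S.
  DependsOnly : ∀ {n} → Subset n → (Interpretation n → Carrier) → Set ℓ
  DependsOnly S F = ∀ I J → Agree S I J → F I ≈ F J

  dependsOnly-∷ : ∀ {n s} {S : Subset n} {F} → DependsOnly (s Vec.∷ S) F →
                  ∀ b → DependsOnly S (F ∘ (b Vec.∷_))
  dependsOnly-∷ dep b I J eq = dep _ _ λ where
    zero    _         → ≡.refl
    (suc v) (there p) → eq v p

  dependsOnly-outside : ∀ {n} {S : Subset n} {F} → DependsOnly (outside Vec.∷ S) F →
                        ∀ b b′ I → F (b Vec.∷ I) ≈ F (b′ Vec.∷ I)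
  dependsOnly-outside dep b b′ I = dep _ _ λ where
    (suc v) (there p) → ≡.refl

  sumOver-cong : ∀ {n} (S : Subset n) α {F G} → (∀ I → F I ≈ G I) →
                 sumOver S α F ≈ sumOver S α G
  sumOver-cong Vec.[]            α eq = eq Vec.[]
  sumOver-cong (inside  Vec.∷ S) α eq =
    +-cong (*-congˡ (sumOver-cong S _ (eq ∘ (true Vec.∷_))))
           (*-congˡ (sumOver-cong S _ (eq ∘ (false Vec.∷_))))
  sumOver-cong (outside Vec.∷ S) α eq = sumOver-cong S _ (eq ∘ (true Vec.∷_))

  sumOver-0 : ∀ {n} (S : Subset n) α → sumOver S α (λ _ → 0#) ≈ 0#
  sumOver-0 Vec.[]            α = refl
  sumOver-0 (inside  Vec.∷ S) α = begin
    α (pos zero) * sumOver S _ (λ _ → 0#) + α (neg zero) * sumOver S _ (λ _ → 0#)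
      ≈⟨ +-cong (*-congˡ (sumOver-0 S _)) (*-congˡ (sumOver-0 S _)) ⟩
    α (pos zero) * 0# + α (neg zero) * 0#
      ≈⟨ +-cong (zeroʳ _) (zeroʳ _) ⟩
    0# + 0#
      ≈⟨ +-identityˡ 0# ⟩
    0# ∎
  sumOver-0 (outside Vec.∷ S) α = sumOver-0 S _

  sumOver-+ : ∀ {n} (S : Subset n) α F G →
              sumOver S α (λ I → F I + G I) ≈ sumOver S α F + sumOver S α G
  sumOver-+ Vec.[]            α F G = refl
  sumOver-+ (outside Vec.∷ S) α F G = sumOver-+ S _ _ _
  sumOver-+ (inside  Vec.∷ S) α F G = begin
    α (pos zero) * sumOver S _ _ + α (neg zero) * sumOver S _ _
      ≈⟨ +-cong (*-congˡ (sumOver-+ S _ _ _)) (*-congˡ (sumOver-+ S _ _ _)) ⟩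
    α (pos zero) * (_ + _) + α (neg zero) * (_ + _)
      ≈⟨ +-cong (distribˡ _ _ _) (distribˡ _ _ _) ⟩
    (_ + _) + (_ + _)
      ≈⟨ +-interchange _ _ _ _ ⟩
    (_ + _) + (_ + _) ∎

  sumOver-⊥ : ∀ {n} α a → sumOver {n} Subset.⊥ α (λ _ → a) ≈ a
  sumOver-⊥ {ℕ.zero} α a = refl
  sumOver-⊥ {suc n}  α a = sumOver-⊥ {n} _ a

  -- Fubini for functions of disjoint sets of variables.
  sumOver-* : ∀ {n} (S T : Subset n) α F G → Empty (S ∩ T) →
              DependsOnly S F → DependsOnly T G →
              sumOver (S ∪ T) α (λ I → F I * G I) ≈ sumOver S α F * sumOver T α G
  sumOver-* Vec.[] Vec.[] α F G dis dF dG = refl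
  sumOver-* (inside Vec.∷ S) (inside Vec.∷ T) α F G dis dF dG = ⊥-elim (dis (zero , here))
  sumOver-* (outside Vec.∷ S) (outside Vec.∷ T) α F G dis dF dG =
    sumOver-* S T _ _ _ (drop-∷-Empty dis) (dependsOnly-∷ dF true) (dependsOnly-∷ dG true)
  sumOver-* (inside Vec.∷ S) (outside Vec.∷ T) α F G dis dF dG = begin
    p * sumOver (S ∪ T) _ (λ I → F (true Vec.∷ I) * G (true Vec.∷ I)) +
    q * sumOver (S ∪ T) _ (λ I → F (false Vec.∷ I) * G (false Vec.∷ I))
      ≈⟨ +-cong (branch true p) (branch false q) ⟩
    p * F′ true * G′ + q * F′ false * G′
      ≈⟨ distribʳ G′ _ _ ⟨
    (p * F′ true + q * F′ false) * G′ ∎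
    where
    p = α (pos zero)
    q = α (neg zero)
    F′ : Bool → Carrier
    F′ b = sumOver S (α ∘ raise) (F ∘ (b Vec.∷_))
    G′ = sumOver T (α ∘ raise) (G ∘ (true Vec.∷_))
    branch : ∀ b a → a * sumOver (S ∪ T) (α ∘ raise) (λ I → F (b Vec.∷ I) * G (b Vec.∷ I))
                     ≈ a * F′ b * G′
    branch b a = begin
      a * sumOver (S ∪ T) _ (λ I → F (b Vec.∷ I) * G (b Vec.∷ I))
        ≈⟨ *-congˡ (sumOver-cong (S ∪ T) _
             (λ I → *-congˡ (dependsOnly-outside dG b true I))) ⟩
      a * sumOver (S ∪ T) _ (λ I → F (b Vec.∷ I) * G (true Vec.∷ I))
        ≈⟨ *-congˡ (sumOver-* S T _ _ _ (drop-∷-Empty dis)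
             (dependsOnly-∷ dF b) (dependsOnly-∷ dG true)) ⟩
      a * (F′ b * G′)
        ≈⟨ *-assoc _ _ _ ⟨
      a * F′ b * G′ ∎
  sumOver-* (outside Vec.∷ S) (inside Vec.∷ T) α F G dis dF dG = begin
    p * sumOver (S ∪ T) _ (λ I → F (true Vec.∷ I) * G (true Vec.∷ I)) +
    q * sumOver (S ∪ T) _ (λ I → F (false Vec.∷ I) * G (false Vec.∷ I))
      ≈⟨ +-cong (branch true p) (branch false q) ⟩
    F′ * (p * G′ true) + F′ * (q * G′ false)
      ≈⟨ distribˡ F′ _ _ ⟨
    F′ * (p * G′ true + q * G′ false) ∎
    where
    p = α (pos zero)
    q = α (neg zero)
    F′ = sumOver S (α ∘ raise) (F ∘ (true Vec.∷_))
    G′ : Bool → Carrier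
    G′ b = sumOver T (α ∘ raise) (G ∘ (b Vec.∷_))
    branch : ∀ b a → a * sumOver (S ∪ T) (α ∘ raise) (λ I → F (b Vec.∷ I) * G (b Vec.∷ I))
                     ≈ F′ * (a * G′ b)
    branch b a = begin
      a * sumOver (S ∪ T) _ (λ I → F (b Vec.∷ I) * G (b Vec.∷ I))
        ≈⟨ *-congˡ (sumOver-cong (S ∪ T) _
             (λ I → *-congʳ (dependsOnly-outside dF b true I))) ⟩
      a * sumOver (S ∪ T) _ (λ I → F (true Vec.∷ I) * G (b Vec.∷ I))
        ≈⟨ *-congˡ (sumOver-* S T _ _ _ (drop-∷-Empty dis)
             (dependsOnly-∷ dF true) (dependsOnly-∷ dG b)) ⟩
      a * (F′ * G′ b)
        ≈⟨ x*yz≈y*xz _ _ _ ⟩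
      F′ * (a * G′ b) ∎

  -- Indicator functions.

  indicator : Bool → Carrier
  indicator true  = 1#
  indicator false = 0#

  indicator-∧ : ∀ a b → indicator (a ∧ b) ≈ indicator a * indicator b
  indicator-∧ true  b = sym (*-identityˡ _)
  indicator-∧ false b = sym (zeroˡ _)

  indicator-∨ : ∀ a b → ¬ (a ≡ true × b ≡ true) → indicator (a ∨ b) ≈ indicator a + indicator b
  indicator-∨ true  true  p = ⊥-elim (p (≡.refl , ≡.refl))
  indicator-∨ true  false p = sym (+-identityʳ _)
  indicator-∨ false b     p = sym (+-identityˡ _)

  indicator-dependsOnly : ∀ {n} (φ : NNF n) → DependsOnly (vars φ) (λ I → indicator (⟦ φ ⟧ I))
  indicator-dependsOnly φ I J eq = reflexive (cong indicator (⟦⟧-agree φ I J eq))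

  -- Correctness of evaluation at each kind of node.

  -- The value of φ is the weighted sum of its indicator over its own variables.
  Correct : ∀ {n} → (Literal n → Carrier) → NNF n → Set ℓ
  Correct α φ = evalNNF R α φ ≈ sumOver (vars φ) α (λ I → indicator (⟦ φ ⟧ I))

  correct-lit : ∀ {n} (α : Literal n → Carrier) l → Correct α (lit l)
  correct-lit {suc n} α (pos zero) = sym (begin
    p * sumOver Subset.⊥ α′ (λ _ → 1#) + q * sumOver Subset.⊥ α′ (λ _ → 0#)
      ≈⟨ +-cong (*-congˡ (sumOver-⊥ α′ 1#)) (*-congˡ (sumOver-⊥ α′ 0#)) ⟩
    p * 1# + q * 0#  ≈⟨ +-cong (*-identityʳ p) (zeroʳ q) ⟩
    p + 0#           ≈⟨ +-identityʳ p ⟩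
    p                ∎)
    where
    p = α (pos zero)
    q = α (neg zero)
    α′ : Literal n → Carrier
    α′ = α ∘ raise
  correct-lit {suc n} α (neg zero) = sym (begin
    p * sumOver Subset.⊥ α′ (λ _ → 0#) + q * sumOver Subset.⊥ α′ (λ _ → 1#)
      ≈⟨ +-cong (*-congˡ (sumOver-⊥ α′ 0#)) (*-congˡ (sumOver-⊥ α′ 1#)) ⟩
    p * 0# + q * 1#  ≈⟨ +-cong (zeroʳ p) (*-identityʳ q) ⟩
    0# + q           ≈⟨ +-identityˡ q ⟩
    q                ∎)
    where
    p = α (pos zero)
    q = α (neg zero)
    α′ : Literal n → Carrier
    α′ = α ∘ raise
  correct-lit α (pos (suc v)) = correct-lit (α ∘ raise) (pos v)
  correct-lit α (neg (suc v)) = correct-lit (α ∘ raise) (neg v)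

  correct-⋁ : ∀ {n} (α : Literal n → Carrier) φs → All (Correct α) φs →
              AllPairs SameVars φs → AllPairs Inconsistent φs → Correct α (⋁ φs)
  correct-⋁ α φs cs smooth det = go φs cs (smooth-vars φs smooth) det
    where
    -- The set of variables is kept fixed while the list shrinks: for the empty
    -- list the union of the variables would no longer be S.
    go : ∀ {S} φs → All (Correct α) φs → All (λ φ → vars φ ≡ S) φs → AllPairs Inconsistent φs →
         ⨁ R (evalEach R α φs) ≈ sumOver S α (λ I → indicator (any⟦ φs ⟧ I))
    go {S} []     _        _               _        = sym (sumOver-0 S α)
    go (φ ∷ φs) (c ∷ cs) (≡.refl ∷ eqs) (d ∷ ds) = begin
      evalNNF R α φ + ⨁ R (evalEach R α φs)
        ≈⟨ +-cong c (go φs cs eqs ds) ⟩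
      sumOver (vars φ) α (λ I → indicator (⟦ φ ⟧ I)) +
      sumOver (vars φ) α (λ I → indicator (any⟦ φs ⟧ I))
        ≈⟨ sumOver-+ (vars φ) α _ _ ⟨
      sumOver (vars φ) α (λ I → indicator (⟦ φ ⟧ I) + indicator (any⟦ φs ⟧ I))
        ≈⟨ sumOver-cong (vars φ) α (λ I → indicator-∨ (⟦ φ ⟧ I) _ (inconsistent-any φ d I)) ⟨
      sumOver (vars φ) α (λ I → indicator (⟦ φ ⟧ I ∨ any⟦ φs ⟧ I)) ∎

  correct-⋀ : ∀ {n} (α : Literal n → Carrier) φs → All (Correct α) φs →
              AllPairs DisjointVars φs → Correct α (⋀ φs)
  correct-⋀ α []       _        _        = sym (sumOver-⊥ α 1#)
  correct-⋀ α (φ ∷ φs) (c ∷ cs) (d ∷ ds) = begin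
    evalNNF R α φ * ⨂ R (evalEach R α φs)
      ≈⟨ *-cong c (correct-⋀ α φs cs ds) ⟩
    sumOver S α (λ I → indicator (⟦ φ ⟧ I)) * sumOver T α (λ I → indicator (all⟦ φs ⟧ I))
      ≈⟨ sumOver-* S T α _ _ (disjoint-⋃ {φ = φ} d)
           (indicator-dependsOnly φ) (indicator-dependsOnly (⋀ φs)) ⟨
    sumOver (S ∪ T) α (λ I → indicator (⟦ φ ⟧ I) * indicator (all⟦ φs ⟧ I))
      ≈⟨ sumOver-cong (S ∪ T) α (λ I → indicator-∧ (⟦ φ ⟧ I) _) ⟨
    sumOver (S ∪ T) α (λ I → indicator (⟦ φ ⟧ I ∧ all⟦ φs ⟧ I)) ∎
    where
    S = vars φ
    T = vars (⋀ φs)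

  correct-formula : ∀ {n} (α : Literal n → Carrier) (N : Circuit n) → IsSdDNNF N →
                    ∀ u → Correct α (formula N u)
  correct-formula α N sd u = go u (descending N u)
    where
    open Circuit N
    open IsSdDNNF sd
    unfold : ∀ u {g} → label u ≡ g → formula N u ≡ connect N g (λ {w} _ → formula N w)
    unfold u eq = ≡.trans (formula-unfold N u)
                          (cong (λ g → connect N g (λ {w} _ → formula N w)) eq)

    go : ∀ u → Acc (flip _⟶⁺_) u → Correct α (formula N u)
    go u (acc rs) with label u in eq | (λ {w} p → go w (rs [ p ]))
    ... | ⊤     | _  = subst (Correct α) (≡.sym (unfold u eq)) (sym (sumOver-⊥ α 1#))
    ... | ⊥     | _  = subst (Correct α) (≡.sym (unfold u eq)) (sym (sumOver-⊥ α 0#))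
    ... | lit l | _  = subst (Correct α) (≡.sym (unfold u eq)) (correct-lit α l)
    ... | ⋁ us  | ih = subst (Correct α) (≡.sym (formula-⋁ N u eq))
      (correct-⋁ α _ (All.map⁺ (All.tabulate ih)) (smooth u eq) (deterministic u eq))
    ... | ⋀ us  | ih = subst (Correct α) (≡.sym (formula-⋀ N u eq))
      (correct-⋀ α _ (All.map⁺ (All.tabulate ih)) (decomposable u eq))

  -- The model count as a weighted sum over all variables.

  ⨁-++ : ∀ xs ys → ⨁ R (xs ++ ys) ≈ ⨁ R xs + ⨁ R ys
  ⨁-++ []       ys = sym (+-identityˡ _)
  ⨁-++ (x ∷ xs) ys = trans (+-congˡ (⨁-++ xs ys)) (sym (+-assoc x _ _))

  module _ {A : Set} where

    ⨁-map-cong : ∀ {f g : A → Carrier} → (∀ x → f x ≈ g x) →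
                 ∀ xs → ⨁ R (map f xs) ≈ ⨁ R (map g xs)
    ⨁-map-cong eq []       = refl
    ⨁-map-cong eq (x ∷ xs) = +-cong (eq x) (⨁-map-cong eq xs)

    ⨁-map-*ˡ : ∀ a (f : A → Carrier) xs → ⨁ R (map (λ x → a * f x) xs) ≈ a * ⨁ R (map f xs)
    ⨁-map-*ˡ a f []       = sym (zeroʳ a)
    ⨁-map-*ˡ a f (x ∷ xs) = trans (+-congˡ (⨁-map-*ˡ a f xs)) (sym (distribˡ a _ _))

    ⨁-filter : ∀ (p : A → Bool) (f : A → Carrier) xs →
               ⨁ R (map f (filterᵇ p xs)) ≈ ⨁ R (map (λ x → f x * indicator (p x)) xs)
    ⨁-filter p f []       = refl
    ⨁-filter p f (x ∷ xs) with p x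
    ... | true  = +-cong (sym (*-identityʳ _)) (⨁-filter p f xs)
    ... | false = trans (⨁-filter p f xs)
                        (trans (sym (+-identityˡ _)) (+-congʳ (sym (zeroʳ _))))

  -- The product of the labels of the literals true in I.
  weight : ∀ {n} → (Literal n → Carrier) → Interpretation n → Carrier
  weight α I = ⨂ R (map α (literals I))

  weight-∷ : ∀ {n} (α : Literal (suc n) → Carrier) b I →
             weight α (b Vec.∷ I) ≡ α (choose b zero) * weight (α ∘ raise) I
  weight-∷ α b I = ≡.trans (cong (⨂ R ∘ map α) (literals-∷ b I))
    (cong (λ xs → α (choose b zero) * ⨂ R xs) (≡.sym (map-∘ (literals I))))

  sumOver-⊤ : ∀ {n} (α : Literal n → Carrier) F →
              ⨁ R (map (λ I → weight α I * F I) (interpretations n)) ≈ sumOver Subset.⊤ α F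
  sumOver-⊤ {ℕ.zero} α F = trans (+-identityʳ _) (*-identityˡ _)
  sumOver-⊤ {suc n}  α F = begin
    ⨁ R (map f (map (true Vec.∷_) Is ++ map (false Vec.∷_) Is))
      ≡⟨ cong (⨁ R) (map-++ f (map (true Vec.∷_) Is) _) ⟩
    ⨁ R (map f (map (true Vec.∷_) Is) ++ map f (map (false Vec.∷_) Is))
      ≈⟨ ⨁-++ (map f (map (true Vec.∷_) Is)) _ ⟩
    ⨁ R (map f (map (true Vec.∷_) Is)) + ⨁ R (map f (map (false Vec.∷_) Is))
      ≈⟨ +-cong (branch true) (branch false) ⟩
    sumOver Subset.⊤ α F ∎
    where
    Is = interpretations n
    f : Interpretation (suc n) → Carrier
    f I = weight α I * F I
    branch : ∀ b → ⨁ R (map f (map (b Vec.∷_) Is)) ≈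
             α (choose b zero) * sumOver Subset.⊤ (α ∘ raise) (F ∘ (b Vec.∷_))
    branch b = begin
      ⨁ R (map f (map (b Vec.∷_) Is))
        ≡⟨ cong (⨁ R) (map-∘ Is) ⟨
      ⨁ R (map (λ I → weight α (b Vec.∷ I) * F (b Vec.∷ I)) Is)
        ≈⟨ ⨁-map-cong (λ I → trans (*-congʳ (reflexive (weight-∷ α b I))) (*-assoc _ _ _)) Is ⟩
      ⨁ R (map (λ I → α (choose b zero) * (weight (α ∘ raise) I * F (b Vec.∷ I))) Is)
        ≈⟨ ⨁-map-*ˡ _ _ Is ⟩
      α (choose b zero) * ⨁ R (map (λ I → weight (α ∘ raise) I * F (b Vec.∷ I)) Is)
        ≈⟨ *-congˡ (sumOver-⊤ (α ∘ raise) (F ∘ (b Vec.∷_))) ⟩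
      α (choose b zero) * sumOver Subset.⊤ (α ∘ raise) (F ∘ (b Vec.∷_)) ∎

  modelCount-sumOver : ∀ {n} (α : Literal n → Carrier) (T : Theory n) →
    modelCount R α T ≈ sumOver Subset.⊤ α (λ I → indicator (⟦ T ⟧ᵀ I))
  modelCount-sumOver {n} α T =
    trans (⨁-filter ⟦ T ⟧ᵀ (weight α) (interpretations n)) (sumOver-⊤ α _)

theorem2 : ∀ {c ℓ} (R : CommutativeSemiring c ℓ) (n : ℕ) (T : Theory n)
    (α : Literal n → CommutativeSemiring.Carrier R) (N : Circuit n) →
    IsSdDNNF N →
    Represents N T →
    (Satisfiable T → MentionsAllVariables N) →
    CommutativeSemiring._≈_ R (Eval N R α) (modelCount R α T)
theorem2 R n T α N sd represents mentions = begin
  Eval N R α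
    ≈⟨ correct-formula R α N sd root ⟩
  sumOver R S α (λ I → indicator R (⟦ formula N root ⟧ I))
    ≈⟨ sumOver-cong R S α (λ I → reflexive (cong (indicator R) (represents I))) ⟩
  sumOver R S α [T]
    ≈⟨ extend ⟩
  sumOver R Subset.⊤ α [T]
    ≈⟨ modelCount-sumOver R α T ⟨
  modelCount R α T ∎
  where
  open CommutativeSemiring R
  open SetoidReasoning setoid
  open Circuit N
  S = vars (formula N root)
  [T] : Interpretation n → Carrier
  [T] I = indicator R (⟦ T ⟧ᵀ I)

  -- Satisfiability of T need not be decided: comparing S with the set of all
  -- variables suffices.
  extend : sumOver R S α [T] ≈ sumOver R Subset.⊤ α [T]
  extend with ≡-dec _≟ᵇ_ S Subset.⊤
  ... | yes S≡⊤ = reflexive (cong (λ S → sumOver R S α [T]) S≡⊤)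
  ... | no  S≢⊤ = trans (vanishes S) (sym (vanishes Subset.⊤))
    where
    no-model : ∀ I → ⟦ T ⟧ᵀ I ≡ false
    no-model I = ¬-not (λ sat →
      S≢⊤ (⊆-antisym (⊆-max S) (λ {v} _ → mentions (I , sat) v)))
    vanishes : ∀ S → sumOver R S α [T] ≈ 0#
    vanishes S = trans
      (sumOver-cong R S α (λ I → reflexive (cong (indicator R) (no-model I))))
      (sumOver-0 R S α)
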